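{- Let $R$ be a commutative ring with unity, let $m\ge1$ be an integer, and let $\lambda_1:\mathbb N\times\mathbb Z\to R$ be a lambda-recursive family of order $m$ with principal factor $(p_n)_{n\ge m}$. Then the boundary sequence $(\lambda_1(n,0))_{n\ge0}$ is completely determined by the initial values $\lambda_1(0,0),\dots,\lambda_1(m-1,0)$ and by the sequence $(p_n)_{n\ge m}$; equivalently, $$\lambda_1(n,0)=\lambda_1(m-1,0)\prod_{i=m}^{n}p_i\qquad\text{for all } n\ge m.$$
   Context: $\mathbb N=\{0,1,2,\dots\}$ and $w_m(n)=\lfloor n/m\rfloor$. A family $\lambda:\mathbb N\times\mathbb Z\to R$ has triangular support of order $m$ (written $\lambda\in\Delta_m$) if $\lambda(n,k)=0$ whenever $k<0$ or $k>w_m(n)$. A family $\lambda_1\in\Delta_m$ is lambda-recursive of order $m$ if there exist $p_n\in R$ (principal factor), $h_{(n,k)}\in R$ (auxiliary factor) and initial data $c_n\in R$ for $0\le n\le m-1$ such that, for all $n\in\mathbb N$ and $0\le k\le w_m(n)$: $\lambda_1(n,0)=c_n$ if $0\le n\le m-1$ (and $k=0$), and $\lambda_1(n,k)=p_n\,\lambda_1(n-1,k)-h_{(n,k)}\,\lambda_1(n-m,k-1)$ if $n\ge m$. -}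

module Defs where

open import Algebra.Bundles using (CommutativeRing)
open import Level using (_⊔_)
open import Data.Fin.Base using (Fin; toℕ)
open import Data.Integer.Base as ℤ using (ℤ; 0ℤ; 1ℤ; +_)
open import Data.Nat.Base as ℕ using (ℕ; suc; _∸_; NonZero)
open import Data.Nat.DivMod using (_/_)
open import Data.Sum.Base using (_⊎_)
import Algebra.Properties.CommutativeMonoid.Sum as CommutativeMonoidSum

w : (m : ℕ) .{{_ : NonZero m}} → ℕ → ℕ
w m n = n / m

module _ {c ℓ} (R : CommutativeRing c ℓ) where

  open CommutativeRing R

  TriangularSupport : (m : ℕ) .{{_ : NonZero m}} → (ℕ → ℤ → Carrier) → Set ℓ
  TriangularSupport m f =
    ∀ n k → (k ℤ.< 0ℤ) ⊎ (+ (w m n) ℤ.< k) → f n k ≈ 0#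

  -- The factors are total families; the values principal n and auxiliary n k
  -- play no role for n < m.  In `recurrence` the truncated subtractions
  -- n ∸ 1 and n ∸ m are exact, since 1 ≤ m ≤ n.
  record LambdaRecursive (m : ℕ) .{{_ : NonZero m}}
                         (f : ℕ → ℤ → Carrier) : Set (c ⊔ ℓ) where
    field
      support    : TriangularSupport m f
      principal  : ℕ → Carrier
      auxiliary  : ℕ → ℤ → Carrier
      initial    : Fin m → Carrier
      base       : ∀ (i : Fin m) → f (toℕ i) 0ℤ ≈ initial i
      recurrence : ∀ n k → m ℕ.≤ n → 0ℤ ℤ.≤ k → k ℤ.≤ + (w m n) →
                   f n k ≈ principal n * f (n ∸ 1) k
                           - auxiliary n k * f (n ∸ m) (k ℤ.- 1ℤ)

  -- ∏_{i=a}^{b} p i with both ends included (empty, hence 1#, when b < a):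
  -- the library's iterated operation `sum`, taken in the multiplicative monoid.
  prodFromTo : (a b : ℕ) → (ℕ → Carrier) → Carrier
  prodFromTo a b p = sum {suc b ∸ a} (λ i → p (a ℕ.+ toℕ i))
    where open CommutativeMonoidSum *-commutativeMonoid using (sum)

{-# OPTIONS --safe #-}
-- The auxiliary term at k = 0 involves λ₁ (n ∸ m) (-1), which vanishes by
-- triangular support.  Hence the boundary satisfies the first-order recurrence
-- λ₁ n 0 = p n · λ₁ (n - 1) 0 for n ≥ m, which is then unrolled down to m - 1.
module Submission where

open import Defs
open import Algebra.Bundles using (CommutativeRing)
open import Data.Fin.Base using (toℕ)
open import Data.Fin.Properties using (toℕ-fromℕ; toℕ-inject₁)
open import Data.Integer.Base using (ℤ; 0ℤ; +≤+; -<+)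
open import Data.Nat.Base using (ℕ; zero; suc; _+_; _∸_; _≤_; _<_; NonZero; z≤n; s≤s)
open import Data.Nat.Properties using (_<?_; +-identityʳ; +-suc; m≤m+n; m+[n∸m]≡n; ≮⇒≥; <⇒≤)
open import Data.Product.Base using (_×_; _,_)
open import Data.Sum.Base using (inj₁)
open import Relation.Binary.PropositionalEquality as ≡ using ()
open import Relation.Nullary.Decidable using (yes; no)
import Algebra.Properties.Ring as RingProperties
import Algebra.Properties.Monoid.Sum as MonoidSum
import Relation.Binary.Reasoning.Setoid as SetoidReasoning

module _ {c ℓ} (R : CommutativeRing c ℓ) where

  open CommutativeRing R using (Carrier; _≈_; _*_; _-_; 0#; 1#; setoid; ring;
    *-monoid; *-congˡ; *-congʳ; *-cong; +-congˡ; -‿cong; zeroʳ; *-identityʳ; *-assoc;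
    *-comm; reflexive)
    renaming (_+_ to _+ᴿ_; +-identityʳ to +ᴿ-identityʳ; trans to ≈-trans)
  open RingProperties ring using (-0#≈0#)
  open MonoidSum *-monoid using () renaming (sum to ∏; sum-init-last to ∏-init-last; sum-cong-≗ to ∏-cong-≗)
  open SetoidReasoning setoid

  -- `∏` unfolds at its first factor, while the boundary recurrence contributes the factor of
  -- highest index, so the product has to be split at the other end. The indices `inject₁ i` and
  -- `fromℕ k` arising there have values `toℕ i` and `k`.
  ∏-toℕ-suc : (p : ℕ → Carrier) (k : ℕ) →
              ∏ {suc k} (λ i → p (toℕ i)) ≈ ∏ {k} (λ i → p (toℕ i)) * p k
  ∏-toℕ-suc p k = ≈-trans (∏-init-last {k} (λ i → p (toℕ i)))
    (*-cong (reflexive (∏-cong-≗ {k} (λ i → ≡.cong p (toℕ-inject₁ i))))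
            (reflexive (≡.cong p (toℕ-fromℕ k))))

  module _ {m : ℕ} .{{_ : NonZero m}} {f : ℕ → ℤ → Carrier}
           (rec : LambdaRecursive R m f) where

    open LambdaRecursive rec

    boundary-recurrence : ∀ n → m ≤ n → f n 0ℤ ≈ principal n * f (n ∸ 1) 0ℤ
    boundary-recurrence n m≤n = begin
      f n 0ℤ
        ≈⟨ recurrence n 0ℤ m≤n (+≤+ z≤n) (+≤+ z≤n) ⟩
      principal n * f (n ∸ 1) 0ℤ - auxiliary n 0ℤ * f (n ∸ m) _
        -- The hidden second index is `0ℤ - 1ℤ`, which computes to a negative literal; hence `-<+`
        -- suffices.
        ≈⟨ +-congˡ (-‿cong (*-congˡ (support (n ∸ m) _ (inj₁ -<+)))) ⟩
      principal n * f (n ∸ 1) 0ℤ - auxiliary n 0ℤ * 0#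
        ≈⟨ +-congˡ (≈-trans (-‿cong (zeroʳ _)) -0#≈0#) ⟩
      principal n * f (n ∸ 1) 0ℤ +ᴿ 0#
        ≈⟨ +ᴿ-identityʳ _ ⟩
      principal n * f (n ∸ 1) 0ℤ ∎

  -- With order `suc m` and `n` written as `m + k`, `k` counts the factors. The induction can then
  -- start one place before the order, at `f m 0ℤ` with the empty product.
  boundary-product : ∀ {m f} (rec : LambdaRecursive R (suc m) f) (k : ℕ) →
    f (m + k) 0ℤ ≈ f m 0ℤ * ∏ {k} (λ i → LambdaRecursive.principal rec (suc m + toℕ i))
  boundary-product {m} {f} rec zero = begin
    f (m + 0) 0ℤ  ≡⟨ ≡.cong (λ n → f n 0ℤ) (+-identityʳ m) ⟩
    f m 0ℤ        ≈⟨ *-identityʳ _ ⟨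
    f m 0ℤ * 1#   ∎
  boundary-product {m} {f} rec (suc k) = begin
    f (m + suc k) 0ℤ                ≡⟨ ≡.cong (λ n → f n 0ℤ) (+-suc m k) ⟩
    -- Here `suc m + k ∸ 1` reduces to `m + k`, the index of the induction hypothesis.
    f (suc m + k) 0ℤ                ≈⟨ boundary-recurrence rec (suc m + k) (m≤m+n (suc m) k) ⟩
    p k * f (m + k) 0ℤ              ≈⟨ *-comm _ _ ⟩
    f (m + k) 0ℤ * p k              ≈⟨ *-congʳ (boundary-product rec k) ⟩
    f m 0ℤ * ∏ {k} (λ i → p (toℕ i)) * p k
                                    ≈⟨ *-assoc _ _ _ ⟩
    f m 0ℤ * (∏ {k} (λ i → p (toℕ i)) * p k)
                                    ≈⟨ *-congˡ (∏-toℕ-suc p k) ⟨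
    f m 0ℤ * ∏ {suc k} (λ i → p (toℕ i)) ∎
    where
    p : ℕ → Carrier
    p j = LambdaRecursive.principal rec (suc m + j)

  boundary-unique : ∀ {m} .{{_ : NonZero m}} {f g}
    (recf : LambdaRecursive R m f) (recg : LambdaRecursive R m g) →
    (∀ n → n < m → f n 0ℤ ≈ g n 0ℤ) →
    (∀ n → m ≤ n → LambdaRecursive.principal recf n ≈ LambdaRecursive.principal recg n) →
    ∀ n → f n 0ℤ ≈ g n 0ℤ
  -- `NonZero` excludes order 0, so index 0 always lies in the initial range.
  boundary-unique {suc m} recf recg init≈ p≈ zero = init≈ 0 (s≤s z≤n)
  boundary-unique {m} {f} {g} recf recg init≈ p≈ (suc n) with suc n <? m
  ... | yes n<m = init≈ (suc n) n<m
  ... | no  n≮m = begin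
    f (suc n) 0ℤ
      ≈⟨ boundary-recurrence recf (suc n) m≤n ⟩
    LambdaRecursive.principal recf (suc n) * f n 0ℤ
      -- When `suc n` equals `m`, the recursive call lands among the initial values.
      ≈⟨ *-cong (p≈ (suc n) m≤n) (boundary-unique recf recg init≈ p≈ n) ⟩
    LambdaRecursive.principal recg (suc n) * g n 0ℤ
      ≈⟨ boundary-recurrence recg (suc n) m≤n ⟨
    g (suc n) 0ℤ ∎
    where m≤n = ≮⇒≥ n≮m

theorem3p6 : ∀ {c ℓ} (R : CommutativeRing c ℓ) (m : ℕ) .{{_ : NonZero m}} →
    let open CommutativeRing R in
    (λ₁ : ℕ → ℤ → Carrier) (rec : LambdaRecursive R m λ₁) →
    ((λ₁′ : ℕ → ℤ → Carrier) (rec′ : LambdaRecursive R m λ₁′) →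
    (∀ n → n < m → λ₁ n 0ℤ ≈ λ₁′ n 0ℤ) →
    (∀ n → m ≤ n → LambdaRecursive.principal rec n ≈ LambdaRecursive.principal rec′ n) →
    ∀ n → λ₁ n 0ℤ ≈ λ₁′ n 0ℤ)
    ×
    (∀ n → m ≤ n →
    λ₁ n 0ℤ ≈ λ₁ (m ∸ 1) 0ℤ * prodFromTo R m n (LambdaRecursive.principal rec))
theorem3p6 R (suc m) λ₁ rec =
  (λ λ₁′ rec′ → boundary-unique R rec rec′) ,
  -- For order `suc m` the bound `suc m ≤ n` is `m < n`, and `prodFromTo` has `suc n ∸ suc m`
  -- factors, which reduces to `n ∸ m`; so `k = n ∸ m` gives exactly the required product.
  λ n m<n → trans
    (reflexive (≡.cong (λ l → λ₁ l 0ℤ) (≡.sym (m+[n∸m]≡n (<⇒≤ m<n)))))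
    (boundary-product R rec (n ∸ m))
  where open CommutativeRing R using (trans; reflexive)
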